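{- If $\mathfrak{g}$ is either atom or loose guards, then for $k>0$ and $\sigma$-structures $\mathcal{A},\mathcal{B}$, there is a bijective correspondence between (1) coKleisli morphisms ($\sigma$-homomorphisms) $\mathbb{G}_{k}^{\mathfrak{g}} \mathcal{A} \to \mathcal{B}$, and (2) winning strategies for Duplicator in the $\mathfrak{g}$-guarded $k$-bounded simulation game from $\mathcal{A}$ to $\mathcal{B}$. Thus $\mathcal{A} \preceq^{\mathfrak{g}}_{k} \mathcal{B}$ iff there is a homomorphism $\mathbb{G}_{k}^{\mathfrak{g}} \mathcal{A} \to \mathcal{B}$.
   Context: A set is $k$-guarded (atom/loose) if contained in the support of a tuple of length at most $k$ satisfying an atom/loose guard. $\mathbb{G}_k^{\mathfrak{g}}\mathcal{A}$ is the $\sigma$-structure whose universe consists of equivalence classes $[p,a]$ of focussed plays $\langle p,a\rangle$, where $p=[U_1,\ldots,U_n]$ is a non-empty list of $k$-guarded $\mathfrak{g}$-guarded sets of $\mathcal{A}$ and $a\in U_n$; $\langle p,a\rangle\sim\langle q,a'\rangle$ iff $a=a'$, the greatest common prefix $p\sqcap q$ is non-empty, and $a$ lies in the last element of every play on the prefix-order paths from $p\sqcap q$ to $p$ and to $q$; $R^{\mathbb{G}_k\mathcal{A}} = \{([p,a_1],\ldots,[p,a_r]) \mid R^{\mathcal{A}}(a_1,\ldots,a_r)\}$. The $k$-bounded $\mathfrak{g}$-guarded simulation game from $\mathcal{A}$ to $\mathcal{B}$: starting with $X_0=\varnothing,\varphi_0=\varnothing$, in each round Spoiler picks a $k$-guarded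 set $X_{n+1}$ in $\mathcal{A}$ and Duplicator responds with a $k$-guarded set $Y_{n+1}$ in $\mathcal{B}$ and a partial homomorphism $\varphi_{n+1}:X_{n+1}\to Y_{n+1}$ agreeing with $\varphi_n$ on $X_{n+1}\cap X_n$; Duplicator wins if he can always respond. $\mathcal{A}\preceq^{\mathfrak{g}}_k\mathcal{B}$ means Duplicator has a winning strategy.
   Formalization: Two winning strategies for Duplicator count as equal when all their partial homomorphisms agree, whatever guarded sets Y are chosen; if the Y were compared too, the bijection would fail, e.g. for one-point structures when Spoiler picks the empty set. -}

module Defs where

open import Axiom.ExcludedMiddle using (ExcludedMiddle)
open import Data.Empty using (⊥; ⊥-elim)
open import Data.Fin.Base using (Fin)
open import Data.List.Base using (List; []; _∷_; [_]; initLast; _∷ʳ′_)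
open import Data.List.NonEmpty.Base using (List⁺; _∷_; toList; last; _⁺∷ʳ_)
open import Data.List.Relation.Binary.Pointwise using (Pointwise)
open import Data.List.Relation.Binary.Prefix.Heterogeneous using (Prefix; []; _∷_)
open import Data.List.Relation.Unary.All using (All)
open import Data.List.Relation.Unary.Any using (Any)
open import Data.Nat.Base using (ℕ; _≤_)
open import Data.Product.Base using (Σ; Σ-syntax; ∃-syntax; _×_; _,_; proj₁; proj₂)
open import Data.Sum.Base using (_⊎_; inj₁; inj₂)
open import Function.Base using (_∘_)
open import Level using (Level; _⊔_; suc)
open import Relation.Binary.Bundles using (Setoid)
open import Relation.Binary.Construct.Closure.Equivalence using (EqClosure)
import Relation.Binary.Construct.Closure.Equivalence as EqC
open import Relation.Binary.Definitions using (_Respects_)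
open import Relation.Binary.PropositionalEquality.Core using (_≡_; refl)
open import Relation.Binary.Structures using (IsEquivalence)
open import Relation.Nullary.Decidable.Core using (yes; no)
open import Relation.Unary using (Pred; _∈_; _⊆_; _≐_)

------------------------------------------------------------------------
-- Relational structures

record Signature (s : Level) : Set (suc s) where
  field
    Symbol : Set s
    arity  : Symbol → ℕ

open Signature public

-- Universes are setoids, since the universe of 𝔾 below is a quotient.

record Structure {s : Level} (σ : Signature s) (ℓ : Level) : Set (s ⊔ suc ℓ) where
  field
    universe : Setoid ℓ ℓ

  open Setoid universe public

  Tuple : ℕ → Set ℓ
  Tuple n = Fin n → Carrier

  field
    ⟦_⟧    : (R : Symbol σ) → Pred (Tuple (arity σ R)) ℓ
    ⟦⟧-resp : ∀ R {as bs} → (∀ i → as i ≈ bs i) → as ∈ ⟦ R ⟧ → bs ∈ ⟦ R ⟧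

record Hom {s ℓ ℓ′ : Level} {σ : Signature s}
           (A : Structure σ ℓ) (B : Structure σ ℓ′) : Set (s ⊔ ℓ ⊔ ℓ′) where
  private
    module A = Structure A
    module B = Structure B
  field
    to        : A.Carrier → B.Carrier
    cong      : ∀ {x y} → x A.≈ y → to x B.≈ to y
    preserves : ∀ R {as} → as ∈ A.⟦ R ⟧ → (to ∘ as) ∈ B.⟦ R ⟧

Homs : {s ℓ ℓ′ : Level} {σ : Signature s} →
       Structure σ ℓ → Structure σ ℓ′ → Setoid (s ⊔ ℓ ⊔ ℓ′) (ℓ ⊔ ℓ′)
Homs A B = record
  { Carrier       = Hom A B
  ; _≈_           = λ f g → ∀ x → Hom.to f x B.≈ Hom.to g x
  ; isEquivalence = record
    { refl  = λ x → B.refl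
    ; sym   = λ e x → B.sym (e x)
    ; trans = λ e e′ x → B.trans (e x) (e′ x)
    }
  }
  where module B = Structure B

------------------------------------------------------------------------
-- Guards

-- Atomic formulas in the variables x₀, …, xₙ₋₁.  Equality atoms are
-- included, so the guard x₀ = x₀ makes every singleton guarded.

data Atom {s : Level} (σ : Signature s) (n : ℕ) : Set s where
  rel : (R : Symbol σ) → (Fin (arity σ R) → Fin n) → Atom σ n
  eq  : Fin n → Fin n → Atom σ n

_occursIn_ : {s : Level} {σ : Signature s} {n : ℕ} → Fin n → Atom σ n → Set
i occursIn rel R xs = ∃[ j ] xs j ≡ i
i occursIn eq x y   = x ≡ i ⊎ y ≡ i

data GuardKind : Set where
  atom loose : GuardKind

-- Guards whose free variables are exactly x₀, …, xₙ₋₁.  A loose guard is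
-- a conjunction of atoms in which any two variables occur together in
-- some conjunct; the case i = j says that every variable does occur.

Guard : {s : Level} → GuardKind → Signature s → ℕ → Set s
Guard atom  σ n = Σ[ α ∈ Atom σ n ] (∀ i → i occursIn α)
Guard loose σ n =
  Σ[ αs ∈ List (Atom σ n) ]
    (∀ i j → Any (λ α → i occursIn α × j occursIn α) αs)

conjuncts : {s : Level} {σ : Signature s} (𝔤 : GuardKind) {n : ℕ} →
            Guard 𝔤 σ n → List (Atom σ n)
conjuncts atom  (α , _)  = [ α ]
conjuncts loose (αs , _) = αs

module _ {s ℓ : Level} {σ : Signature s} (A : Structure σ ℓ) where
  open Structure A

  Satisfies : {n : ℕ} → Tuple n → Atom σ n → Set ℓ
  Satisfies as (rel R xs) = (as ∘ xs) ∈ ⟦ R ⟧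
  Satisfies as (eq x y)   = as x ≈ as y

  SatisfiesGuard : (𝔤 : GuardKind) {n : ℕ} → Tuple n → Guard 𝔤 σ n → Set (s ⊔ ℓ)
  SatisfiesGuard 𝔤 as G = All (Satisfies as) (conjuncts 𝔤 G)

  support : {n : ℕ} → Tuple n → Pred Carrier ℓ
  support as x = ∃[ i ] x ≈ as i

  IsGuarded : GuardKind → ℕ → Pred Carrier ℓ → Set (s ⊔ ℓ)
  IsGuarded 𝔤 k U =
    ∃[ n ] n ≤ k × (Σ[ as ∈ Tuple n ] Σ[ G ∈ Guard 𝔤 σ n ]
      SatisfiesGuard 𝔤 as G × U ⊆ support as)

  record GuardedSet (𝔤 : GuardKind) (k : ℕ) : Set (s ⊔ suc ℓ) where
    field
      elements  : Pred Carrier ℓ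
      resp      : elements Respects _≈_
      isGuarded : IsGuarded 𝔤 k elements

open GuardedSet public using (elements)

module _ {s ℓ : Level} {σ : Signature s} {A : Structure σ ℓ} {𝔤 : GuardKind} {k : ℕ} where

  infix 4 _∈ᵍ_ _≐ᵍ_

  _∈ᵍ_ : Structure.Carrier A → GuardedSet A 𝔤 k → Set ℓ
  x ∈ᵍ U = x ∈ elements U

  _≐ᵍ_ : GuardedSet A 𝔤 k → GuardedSet A 𝔤 k → Set ℓ
  U ≐ᵍ V = elements U ≐ elements V

------------------------------------------------------------------------
-- Plays and the structure 𝔾

module _ {s ℓ : Level} {σ : Signature s} (𝔤 : GuardKind) (k : ℕ) (A : Structure σ ℓ) where
  open Structure A

  Play : Set (s ⊔ suc ℓ)
  Play = List⁺ (GuardedSet A 𝔤 k)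

  infix 4 _≋_ _⊑_ _∼_

  _≋_ : Play → Play → Set (s ⊔ suc ℓ)
  p ≋ q = Pointwise _≐ᵍ_ (toList p) (toList q)

  _⊑_ : List (GuardedSet A 𝔤 k) → List (GuardedSet A 𝔤 k) → Set (s ⊔ suc ℓ)
  _⊑_ = Prefix _≐ᵍ_

  record IsGreatestCommonPrefix (r p q : List (GuardedSet A 𝔤 k)) : Set (s ⊔ suc ℓ) where
    field
      lowerˡ   : r ⊑ p
      lowerʳ   : r ⊑ q
      greatest : ∀ t → t ⊑ p → t ⊑ q → t ⊑ r

  LiesOnPath : Carrier → Play → Play → Set (s ⊔ suc ℓ)
  LiesOnPath a r p = ∀ (t : Play) → toList r ⊑ toList t → toList t ⊑ toList p → a ∈ᵍ last t

  FocussedPlay : Set (s ⊔ suc ℓ)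
  FocussedPlay = Σ[ p ∈ Play ] Σ[ a ∈ Carrier ] a ∈ᵍ last p

  _∼_ : FocussedPlay → FocussedPlay → Set (s ⊔ suc ℓ)
  (p , a , _) ∼ (q , b , _) =
    a ≈ b × (Σ[ r ∈ Play ]
      IsGreatestCommonPrefix (toList r) (toList p) (toList q)
      × LiesOnPath a r p × LiesOnPath b r q)

  -- Classically _∼_ is an equivalence relation (∼-isEquivalence below), so
  -- taking the closure changes nothing.  Constructively transitivity is
  -- not available, as the greatest common prefix of two plays cannot be
  -- computed without deciding equality of sets.

  𝔾 : Structure σ (s ⊔ suc ℓ)
  𝔾 = record
    { universe = EqC.setoid _∼_
    ; ⟦_⟧     = λ R xs →
        Σ[ p ∈ Play ] Σ[ as ∈ Tuple (arity σ R) ] Σ[ m ∈ (∀ i → as i ∈ᵍ last p) ]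
          as ∈ ⟦ R ⟧ × (∀ i → EqClosure _∼_ (xs i) (p , as i , m i))
    ; ⟦⟧-resp = λ R xs≈ys (p , as , m , h , e) →
        p , as , m , h ,
        λ i → EqC.transitive _∼_ (EqC.symmetric _∼_ (xs≈ys i)) (e i)
    }

------------------------------------------------------------------------
-- The simulation game

module _ {s ℓ : Level} {σ : Signature s} (𝔤 : GuardKind) (k : ℕ) (A B : Structure σ ℓ) where
  private
    module A = Structure A
    module B = Structure B

  record PartialHom (X : GuardedSet A 𝔤 k) (Y : GuardedSet B 𝔤 k) : Set (s ⊔ ℓ) where
    field
      to        : ∀ x → x ∈ᵍ X → B.Carrier
      cong      : ∀ {x y} (mx : x ∈ᵍ X) (my : y ∈ᵍ X) → x A.≈ y → to x mx B.≈ to y my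
      into      : ∀ x (m : x ∈ᵍ X) → to x m ∈ᵍ Y
      preserves : ∀ R {as} (m : ∀ i → as i ∈ᵍ X) →
                  as ∈ A.⟦ R ⟧ → (λ i → to (as i) (m i)) ∈ B.⟦ R ⟧

  -- Y p and φ p are Duplicator's answer to the last of Spoiler's moves
  -- p = [X₁, …, Xₙ].  Moves are sets, so extensionally equal sequences of
  -- moves get equal answers.

  record Strategy : Set (s ⊔ suc ℓ) where
    field
      Y      : Play 𝔤 k A → GuardedSet B 𝔤 k
      φ      : ∀ p → PartialHom (last p) (Y p)
      Y-cong : ∀ {p q} → _≋_ 𝔤 k A p q → Y p ≐ᵍ Y q
      φ-cong : ∀ {p q} → _≋_ 𝔤 k A p q → ∀ {x} (m : x ∈ᵍ last p) (m′ : x ∈ᵍ last q) →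
               PartialHom.to (φ p) x m B.≈ PartialHom.to (φ q) x m′

  -- The first round imposes no agreement condition because X₀ = ∅.

  record WinningStrategy : Set (s ⊔ suc ℓ) where
    field
      strategy : Strategy
    open Strategy strategy public
    field
      agrees : ∀ p X {x} (m : x ∈ᵍ last p) (m′ : x ∈ᵍ last (p ⁺∷ʳ X)) →
               PartialHom.to (φ (p ⁺∷ʳ X)) x m′ B.≈ PartialHom.to (φ p) x m

  -- Strategies are identified when they answer with the same partial maps
  -- φ.  The sets Y only bound the ranges of the φ: if B has a guarded pair
  -- {b, c}, the answers {b} and {b, c} to a singleton with the same map
  -- into {b} would otherwise give distinct strategies for one and the same
  -- homomorphism.

  WinningStrategies : Setoid (s ⊔ suc ℓ) (s ⊔ suc ℓ)
  WinningStrategies = record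
    { Carrier       = WinningStrategy
    ; _≈_           = λ S T → ∀ p x (m : x ∈ᵍ last p) →
        PartialHom.to (WinningStrategy.φ S p) x m B.≈ PartialHom.to (WinningStrategy.φ T p) x m
    ; isEquivalence = record
      { refl  = λ p x m → B.refl
      ; sym   = λ e p x m → B.sym (e p x m)
      ; trans = λ e e′ p x m → B.trans (e p x m) (e′ p x m)
      }
    }

_≼[_,_]_ : {s ℓ : Level} {σ : Signature s} →
           Structure σ ℓ → GuardKind → ℕ → Structure σ ℓ → Set (s ⊔ suc ℓ)
A ≼[ 𝔤 , k ] B = WinningStrategy 𝔤 k A B

------------------------------------------------------------------------
-- With excluded middle, _∼_ is an equivalence relation

module _ {s ℓ : Level} {σ : Signature s} (𝔤 : GuardKind) (k : ℕ) (A : Structure σ ℓ) where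
  open Structure A using (_≈_)
  private
    module A = Structure A
    G = GuardedSet A 𝔤 k

    infix 4 _≤ₚ_
    _≤ₚ_ : List G → List G → Set (s ⊔ suc ℓ)
    _≤ₚ_ = _⊑_ 𝔤 k A

    ≐-sym : {U V : Pred A.Carrier ℓ} → U ≐ V → V ≐ U
    ≐-sym (f , g) = g , f

    ≐-trans : {U V W : Pred A.Carrier ℓ} → U ≐ V → V ≐ W → U ≐ W
    ≐-trans (f , g) (f′ , g′) = (λ x → f′ (f x)) , (λ x → g (g′ x))

    ⊑-refl : ∀ xs → xs ≤ₚ xs
    ⊑-refl []       = []
    ⊑-refl (x ∷ xs) = ((λ m → m) , (λ m → m)) ∷ ⊑-refl xs

    ⊑-trans : ∀ {xs ys zs} → xs ≤ₚ ys → ys ≤ₚ zs → xs ≤ₚ zs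
    ⊑-trans []       _        = []
    ⊑-trans (e ∷ es) (f ∷ fs) = ≐-trans e f ∷ ⊑-trans es fs

    ⊑-total : ∀ {xs ys zs} → xs ≤ₚ zs → ys ≤ₚ zs → xs ≤ₚ ys ⊎ ys ≤ₚ xs
    ⊑-total []       _        = inj₁ []
    ⊑-total (_ ∷ _)  []       = inj₂ []
    ⊑-total (e ∷ es) (f ∷ fs) with ⊑-total es fs
    ... | inj₁ h = inj₁ (≐-trans e (≐-sym f) ∷ h)
    ... | inj₂ h = inj₂ (≐-trans f (≐-sym e) ∷ h)

    GCP : (r p q : List G) → Set (s ⊔ suc ℓ)
    GCP = IsGreatestCommonPrefix 𝔤 k A

    nil-gcp : ∀ {p q} → (∀ {t ts} → t ∷ ts ≤ₚ p → t ∷ ts ≤ₚ q → ⊥) → GCP [] p q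
    nil-gcp f = record
      { lowerˡ = [] ; lowerʳ = []
      ; greatest = λ { [] _ _ → [] ; (t ∷ ts) u v → ⊥-elim (f u v) } }

    gcp : ExcludedMiddle ℓ → ∀ p q → ∃[ r ] GCP r p q
    gcp em []       q        = [] , nil-gcp λ ()
    gcp em (x ∷ p)  []       = [] , nil-gcp λ _ ()
    gcp em (x ∷ p)  (y ∷ q)  with em {x ≐ᵍ y}
    ... | no x≭y = [] , nil-gcp λ { (e ∷ _) (f ∷ _) → x≭y (≐-trans (≐-sym e) f) }
    ... | yes x≐y with gcp em p q
    ...   | r , h = x ∷ r , record
      { lowerˡ   = ((λ m → m) , (λ m → m)) ∷ lowerˡ
      ; lowerʳ   = x≐y ∷ lowerʳ
      ; greatest = λ { [] _ _ → [] ; (t ∷ ts) (e ∷ es) (_ ∷ fs) → e ∷ greatest ts es fs }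
      }
      where open IsGreatestCommonPrefix h

    last-∷ : ∀ (x y : G) zs → last (x ∷ y ∷ zs) ≡ last (y ∷ zs)
    last-∷ x y zs with initLast zs
    ... | []      = refl
    ... | _ ∷ʳ′ _ = refl

    last-⊆ : ∀ (p q : Play 𝔤 k A) → toList p ≤ₚ toList q → toList q ≤ₚ toList p →
             elements (last p) ⊆ elements (last q)
    last-⊆ (x ∷ [])     (y ∷ [])     ((f , _) ∷ _) _       = f
    last-⊆ (x ∷ u ∷ us) (y ∷ [])     (_ ∷ ())      _
    last-⊆ (x ∷ [])     (y ∷ v ∷ vs) _             (_ ∷ ())
    last-⊆ (x ∷ u ∷ us) (y ∷ v ∷ vs) (_ ∷ es)      (_ ∷ fs)
      rewrite last-∷ x u us | last-∷ y v vs = last-⊆ (u ∷ us) (v ∷ vs) es fs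

    refl-∼ : ∀ P → _∼_ 𝔤 k A P P
    refl-∼ (p , a , m) = A.refl , p ,
      record { lowerˡ = ⊑-refl _ ; lowerʳ = ⊑-refl _ ; greatest = λ _ e _ → e } ,
      stays , stays
      where
      stays : LiesOnPath 𝔤 k A a p p
      stays t e f = last-⊆ p t e f m

    sym-∼ : ∀ P Q → _∼_ 𝔤 k A P Q → _∼_ 𝔤 k A Q P
    sym-∼ _ _ (a≈b , r , g , l , l′) = A.sym a≈b , r ,
      record { lowerˡ = lowerʳ ; lowerʳ = lowerˡ ; greatest = λ t e f → greatest t f e } , l′ , l
      where open IsGreatestCommonPrefix g

    -- If r ⊑ r′ for the meets r of p, q and r′ of q, u, the meet of p, u
    -- extends r; a path from it to u may pass through plays below r′,
    -- which lie on the path from r to q.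
    trans-∼′ : ExcludedMiddle ℓ → ∀ P Q U (PQ : _∼_ 𝔤 k A P Q) (QU : _∼_ 𝔤 k A Q U) →
               toList (proj₁ (proj₂ PQ)) ≤ₚ toList (proj₁ (proj₂ QU)) → _∼_ 𝔤 k A P U
    trans-∼′ em (p , a , _) (q , b , _) (u , c , _) (a≈b , r , g , lp , lq) (b≈c , r′ , g′ , lq′ , lu) r⊑r′
      with gcp em (toList p) (toList u)
    ... | [] , h with () ← IsGreatestCommonPrefix.greatest h (toList r)
                            (IsGreatestCommonPrefix.lowerˡ g)
                            (⊑-trans r⊑r′ (IsGreatestCommonPrefix.lowerʳ g′))
    ... | x ∷ xs , h = A.trans a≈b b≈c , x ∷ xs , h , onp , onu
      where
      module g  = IsGreatestCommonPrefix g
      module g′ = IsGreatestCommonPrefix g′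

      r⊑m : toList r ≤ₚ x ∷ xs
      r⊑m = IsGreatestCommonPrefix.greatest h (toList r) g.lowerˡ (⊑-trans r⊑r′ g′.lowerʳ)

      onp : LiesOnPath 𝔤 k A a (x ∷ xs) p
      onp t e f = lp t (⊑-trans r⊑m e) f

      onu : LiesOnPath 𝔤 k A c (x ∷ xs) u
      onu t e f with ⊑-total g′.lowerʳ f
      ... | inj₁ r′⊑t = lu t r′⊑t f
      ... | inj₂ t⊑r′ = GuardedSet.resp (last t) b≈c
                          (lq t (⊑-trans r⊑m e) (⊑-trans t⊑r′ g′.lowerˡ))

  ∼-isEquivalence : ExcludedMiddle ℓ → IsEquivalence (_∼_ 𝔤 k A)
  ∼-isEquivalence em = record
    { refl  = λ {P} → refl-∼ P
    ; sym   = λ {P} {Q} → sym-∼ P Q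
    ; trans = λ {P} {Q} {U} → trans P Q U
    }
    where
    trans : ∀ P Q U → _∼_ 𝔤 k A P Q → _∼_ 𝔤 k A Q U → _∼_ 𝔤 k A P U
    trans P Q U PQ@(_ , r , g , _) QU@(_ , r′ , g′ , _)
      with ⊑-total (IsGreatestCommonPrefix.lowerʳ g) (IsGreatestCommonPrefix.lowerˡ g′)
    ... | inj₁ r⊑r′ = trans-∼′ em P Q U PQ QU r⊑r′
    ... | inj₂ r′⊑r = sym-∼ U P (trans-∼′ em U Q P (sym-∼ Q U QU) (sym-∼ P Q PQ) r′⊑r)

{-# OPTIONS --safe #-}
module Submission where

-- A focussed play ⟨p , a⟩ depends only on the play p and the focus a, and it
-- is identified with ⟨p·V , a⟩ whenever a survives the move V.  Conversely
-- these one-step identifications generate ∼, so well-definedness of a map on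
-- classes is the agreement condition of the game.  Hence φ p x = h [p , x]
-- translates both ways.  For Duplicator's sets, a guarded U need not contain
-- its guarding tuple as, on which h [p , -] may be undefined; but after the
-- additional move V = support as the homomorphism maps as to a guarding tuple
-- for the image of U.

open import Defs
open import Level using (Level)
open import Data.List.Base using ([]; _∷_; _∷ʳ_; initLast; _∷ʳ′_)
open import Data.List.NonEmpty.Base using (List⁺; _∷_; toList; last; _⁺∷ʳ_)
open import Data.List.Relation.Binary.Pointwise as Pointwise using (Pointwise; []; _∷_)
open import Data.List.Relation.Binary.Prefix.Heterogeneous using (Prefix; []; _∷_)
open import Data.List.Relation.Binary.Prefix.Heterogeneous.Properties as Prefix using (fromPointwise)
open import Data.List.Relation.Unary.All as All using ()
open import Data.List.Reverse using (Reverse; reverseView; []; _∶_∶ʳ_)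
open import Data.Nat.Base using (ℕ; _<_)
open import Data.Product.Base using (Σ-syntax; ∃-syntax; _×_; _,_; proj₁; proj₂)
open import Data.Sum.Base using (_⊎_; inj₁; inj₂; [_,_]′)
import Data.Sum.Base as Sum
open import Function.Base using (_∘_; id)
open import Function.Bundles using (Inverse; _⇔_; mk⇔)
open import Relation.Binary.Core using (Rel)
import Relation.Binary.Construct.Closure.Equivalence as EqC
open import Relation.Binary.PropositionalEquality.Core using (_≡_; refl; sym; trans; subst)
import Relation.Binary.Reasoning.Setoid as ≈-Reasoning
open import Relation.Unary using (_∈_; _⊆_)
open import Relation.Unary.Properties using (≐-refl; ≐-sym; ≐-trans)

module _ {a} {A : Set a} where

  last-∷ : ∀ (x y : A) zs → last (x ∷ y ∷ zs) ≡ last (y ∷ zs)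
  last-∷ x y zs with initLast zs
  ... | []      = refl
  ... | _ ∷ʳ′ _ = refl

  last-⁺∷ʳ : ∀ (xs : List⁺ A) x → last (xs ⁺∷ʳ x) ≡ x
  last-⁺∷ʳ (y ∷ ys) x = go y ys
    where
    go : ∀ y ys → last ((y ∷ ys) ⁺∷ʳ x) ≡ x
    go y []       = refl
    go y (z ∷ zs) = trans (last-∷ y z (zs ∷ʳ x)) (go z zs)

  module _ {r} {R : Rel A r} where

    last⁺ : ∀ (xs ys : List⁺ A) → Pointwise R (toList xs) (toList ys) → R (last xs) (last ys)
    last⁺ (x ∷ [])      (y ∷ [])      (r ∷ [])     = r
    last⁺ (x ∷ x′ ∷ xs) (y ∷ y′ ∷ ys) (_ ∷ rs)
      rewrite last-∷ x x′ xs | last-∷ y y′ ys = last⁺ (x′ ∷ xs) (y′ ∷ ys) rs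

    -- Serves to split paths: a play between `p` and `p ⁺∷ʳ X` is one of the two, up to `_≐ᵍ_`.
    Prefix-∷ʳ⁻ : ∀ {xs} ys {y} → Prefix R xs (ys ∷ʳ y) → Prefix R xs ys ⊎ Pointwise R xs (ys ∷ʳ y)
    Prefix-∷ʳ⁻ []       []       = inj₁ []
    Prefix-∷ʳ⁻ []       (r ∷ []) = inj₂ (r ∷ [])
    Prefix-∷ʳ⁻ (_ ∷ ys) []       = inj₁ []
    Prefix-∷ʳ⁻ (_ ∷ ys) (r ∷ rs) = Sum.map (r ∷_) (r ∷_) (Prefix-∷ʳ⁻ ys rs)

    Prefix-∷ʳ⁺ : ∀ {xs ys} y → Prefix R xs ys → Prefix R xs (ys ∷ʳ y)
    Prefix-∷ʳ⁺ y []       = []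
    Prefix-∷ʳ⁺ y (r ∷ rs) = r ∷ Prefix-∷ʳ⁺ y rs

module _ {s ℓ : Level} {σ : Signature s} (𝔤 : GuardKind) (k : ℕ) (A : Structure σ ℓ) where
  private
    module A = Structure A
    P = Play 𝔤 k A
    infix 4 _≤ₚ_ _≋ₚ_ _∼ₚ_
    _≤ₚ_ = _⊑_ 𝔤 k A
    _≋ₚ_ = _≋_ 𝔤 k A
    _∼ₚ_ = _∼_ 𝔤 k A

  ≋-refl : ∀ {p : P} → p ≋ₚ p
  ≋-refl = Pointwise.refl ≐-refl

  ≋-sym : ∀ {p q : P} → p ≋ₚ q → q ≋ₚ p
  ≋-sym = Pointwise.symmetric ≐-sym

  ⊑-trans : ∀ {xs ys zs} → xs ≤ₚ ys → ys ≤ₚ zs → xs ≤ₚ zs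
  ⊑-trans = Prefix.trans ≐-trans

  ⊑-antisym : ∀ {xs ys} → xs ≤ₚ ys → ys ≤ₚ xs → Pointwise _≐ᵍ_ xs ys
  ⊑-antisym = Prefix.antisym (λ e _ → e)

  -- With `p` a prefix of `q`, the greatest common prefix is `p` itself, so only the path to `q`
  -- carries a condition.
  ⊑⇒∼ : ∀ (p q : P) {a b} (m : a ∈ᵍ last p) (n : b ∈ᵍ last q) → toList p ≤ₚ toList q →
        a A.≈ b → LiesOnPath 𝔤 k A b p q → (p , a , m) ∼ₚ (q , b , n)
  ⊑⇒∼ p q m n p⊑q a≈b l = a≈b , p ,
    record { lowerˡ = fromPointwise ≋-refl ; lowerʳ = p⊑q ; greatest = λ _ t⊑p _ → t⊑p } ,
    (λ t p⊑t t⊑p → proj₁ (last⁺ p t (⊑-antisym p⊑t t⊑p)) m) , l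

  ≋⇒∼ : ∀ {p q : P} {a b} (m : a ∈ᵍ last p) (n : b ∈ᵍ last q) → p ≋ₚ q →
        a A.≈ b → (p , a , m) ∼ₚ (q , b , n)
  ≋⇒∼ {p} {q} m n p≋q a≈b = ⊑⇒∼ p q m n (fromPointwise p≋q) a≈b
    λ t p⊑t t⊑q → proj₂ (last⁺ t q (⊑-antisym t⊑q (⊑-trans (fromPointwise (≋-sym p≋q)) p⊑t))) n

  ⁺∷ʳ-∼ : ∀ (p : P) X {a} (m : a ∈ᵍ last p) (n : a ∈ᵍ last (p ⁺∷ʳ X)) →
          (p , a , m) ∼ₚ (p ⁺∷ʳ X , a , n)
  ⁺∷ʳ-∼ p X m n = ⊑⇒∼ p (p ⁺∷ʳ X) m n (Prefix-∷ʳ⁺ X (fromPointwise ≋-refl)) A.refl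
    λ t p⊑t t⊑pX → [ (λ t⊑p → proj₁ (last⁺ p t (⊑-antisym p⊑t t⊑p)) m)
                   , (λ t≋pX → proj₂ (last⁺ t (p ⁺∷ʳ X) t≋pX) n)
                   ]′ (Prefix-∷ʳ⁻ (toList p) t⊑pX)

  supportSet : (U : GuardedSet A 𝔤 k) → GuardedSet A 𝔤 k
  supportSet U = let n , n≤k , as , G , sat , _ = GuardedSet.isGuarded U in record
    { elements  = support A as
    ; resp      = λ x≈y (i , x≈aᵢ) → i , A.trans (A.sym x≈y) x≈aᵢ
    ; isGuarded = n , n≤k , as , G , sat , id
    }

module HomToStrategy {s ℓ : Level} {σ : Signature s} (𝔤 : GuardKind) (k : ℕ)
                     (A B : Structure σ ℓ) (h : Hom (𝔾 𝔤 k A) B) where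
  private
    module A = Structure A
    module B = Structure B
    P = Play 𝔤 k A
  open Hom h using (to; cong; preserves)

  to-cong : ∀ {x y} → _∼_ 𝔤 k A x y → to x B.≈ to y
  to-cong x∼y = cong (EqC.return x∼y)

  to-preserves : ∀ (p : P) R {as : A.Tuple _} (m : ∀ i → as i ∈ᵍ last p) → as ∈ A.⟦ R ⟧ →
                 (λ i → to (p , as i , m i)) ∈ B.⟦ R ⟧
  to-preserves p R {as} m as∈R = preserves R (p , as , m , as∈R , λ i → EqC.reflexive _)

  -- All entries are foci of one play. A relational atom is thus an instance of the relation of `𝔾`,
  -- and an equality atom identifies two classes.
  to-satisfies : ∀ (p : P) {n} (as : A.Tuple n) (m : ∀ i → as i ∈ᵍ last p) (α : Atom σ n) →
                 Satisfies A as α → Satisfies B (λ i → to (p , as i , m i)) α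
  to-satisfies p as m (rel R xs) as∈R  = to-preserves p R (m ∘ xs) as∈R
  to-satisfies p as m (eq i j)   aᵢ≈aⱼ = to-cong (≋⇒∼ 𝔤 k A (m i) (m j) (≋-refl 𝔤 k A) aᵢ≈aⱼ)

  -- The least answer that admits the map `h [p , -]`, closed under the equality of `B`.
  image : P → GuardedSet B 𝔤 k
  image p = record
    { elements  = λ b → ∃[ x ] Σ[ m ∈ x ∈ᵍ last p ] b B.≈ to (p , x , m)
    ; resp      = λ b≈c (x , m , b≈hx) → x , m , B.trans (B.sym b≈c) b≈hx
    ; isGuarded =
        let n , n≤k , as , G , sat , U⊆as = GuardedSet.isGuarded (last p)
            V      = supportSet 𝔤 k A (last p)
            pV     = p ⁺∷ʳ V
            last∋ : elements V ⊆ elements (last pV)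
            last∋  = λ {x} → subst (x ∈ᵍ_) (sym (last-⁺∷ʳ p V))
            m      = λ i → last∋ {as i} (i , A.refl)
        -- Guards are syntactic: `G` is reused in `B` and checked conjunct by conjunct, for both
        -- guard kinds at once.
        in n , n≤k , (λ i → to (pV , as i , m i)) , G ,
           All.map (λ {α} → to-satisfies pV as m α) sat ,
           λ (x , mx , b≈hx) →
             -- The focus `x` survives the move `V` because it equals some `as i`, and can then be
             -- exchanged for that entry.
             let i , x≈aᵢ = U⊆as mx
                 mx′      = last∋ (i , x≈aᵢ)
                 open ≈-Reasoning B.universe
             in i , (begin
               _                     ≈⟨ b≈hx ⟩
               to (p , x , mx)       ≈⟨ to-cong (⁺∷ʳ-∼ 𝔤 k A p V mx mx′) ⟩
               to (pV , x , mx′)     ≈⟨ to-cong (≋⇒∼ 𝔤 k A mx′ (m i) (≋-refl 𝔤 k A) x≈aᵢ) ⟩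
               to (pV , as i , m i)  ∎)
    }

  image-⊆ : ∀ {p q : P} → _≋_ 𝔤 k A p q → elements (image p) ⊆ elements (image q)
  image-⊆ {p} {q} p≋q (x , m , b≈hx) =
    x , m′ , B.trans b≈hx (to-cong (≋⇒∼ 𝔤 k A m m′ p≋q A.refl))
    where m′ = proj₁ (last⁺ p q p≋q) m

  winningStrategy : WinningStrategy 𝔤 k A B
  winningStrategy = record
    { strategy = record
      { Y      = image
      ; φ      = λ p → record
        { to        = λ x m → to (p , x , m)
        ; cong      = λ m n x≈y → to-cong (≋⇒∼ 𝔤 k A m n (≋-refl 𝔤 k A) x≈y)
        ; into      = λ x m → x , m , B.refl
        ; preserves = to-preserves p
        }
      ; Y-cong = λ p≋q → image-⊆ p≋q , image-⊆ (≋-sym 𝔤 k A p≋q)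
      ; φ-cong = λ p≋q m n → to-cong (≋⇒∼ 𝔤 k A m n p≋q A.refl)
      }
    ; agrees = λ p X m n → B.sym (to-cong (⁺∷ʳ-∼ 𝔤 k A p X m n))
    }

module StrategyToHom {s ℓ : Level} {σ : Signature s} (𝔤 : GuardKind) (k : ℕ)
                     (A B : Structure σ ℓ) (S : WinningStrategy 𝔤 k A B) where
  private
    module A = Structure A
    module B = Structure B
    P = Play 𝔤 k A
    infix 4 _≤ₚ_
    _≤ₚ_ = _⊑_ 𝔤 k A
  open WinningStrategy S using (φ; φ-cong; agrees)

  ⟪_⟫ : FocussedPlay 𝔤 k A → B.Carrier
  ⟪ p , a , m ⟫ = PartialHom.to (φ p) a m

  -- Moves are removed from the end, where `agrees` applies, until `r` is reached; the path
  -- condition keeps `a` in every intermediate play. The first move `y` is held apart so that the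
  -- play stays non-empty.
  agrees-on-path : ∀ (r : P) {y ys a} → Reverse ys → toList r ≤ₚ y ∷ ys →
                   LiesOnPath 𝔤 k A a r (y ∷ ys) →
                   (m : a ∈ᵍ last (y ∷ ys)) (n : a ∈ᵍ last r) →
                   ⟪ y ∷ ys , a , m ⟫ B.≈ ⟪ r , a , n ⟫
  agrees-on-path (_ ∷ _ ∷ _) [] (_ ∷ ()) l m n
  agrees-on-path (_ ∷ []) [] (e ∷ []) l m n = φ-cong (≐-sym e ∷ []) m n
  agrees-on-path r {y} (ys ∶ rs ∶ʳ X) r⊑pX l m n with Prefix-∷ʳ⁻ (y ∷ ys) r⊑pX
  ... | inj₂ r≋pX = φ-cong (≋-sym 𝔤 k A r≋pX) m n
  ... | inj₁ r⊑p  = B.trans (agrees p X m′ m)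
    (agrees-on-path r rs r⊑p (λ t r⊑t t⊑p → l t r⊑t (Prefix-∷ʳ⁺ X t⊑p)) m′ n)
    where
    p  = y ∷ ys
    m′ = l p r⊑p (Prefix-∷ʳ⁺ X (fromPointwise (≋-refl 𝔤 k A)))

  ⟪⟫-cong-∼ : ∀ {x y} → _∼_ 𝔤 k A x y → ⟪ x ⟫ B.≈ ⟪ y ⟫
  ⟪⟫-cong-∼ {p@(_ ∷ ps) , a , m} {q@(_ ∷ qs) , b , n} (a≈b , r , g , lp , lq) = begin
    ⟪ p , a , m ⟫   ≈⟨ agrees-on-path r (reverseView ps) lowerˡ lp m m′ ⟩
    ⟪ r , a , m′ ⟫  ≈⟨ PartialHom.cong (φ r) m′ n′ a≈b ⟩
    ⟪ r , b , n′ ⟫  ≈⟨ agrees-on-path r (reverseView qs) lowerʳ lq n n′ ⟨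
    ⟪ q , b , n ⟫   ∎
    where
    open IsGreatestCommonPrefix g
    open ≈-Reasoning B.universe
    -- `r` is the starting point of both paths, so both foci lie in its last set and can be compared
    -- under `φ r`.
    m′ = lp r (fromPointwise (≋-refl 𝔤 k A)) lowerˡ
    n′ = lq r (fromPointwise (≋-refl 𝔤 k A)) lowerʳ

  ⟪⟫-cong : ∀ {x y} → EqC.EqClosure (_∼_ 𝔤 k A) x y → ⟪ x ⟫ B.≈ ⟪ y ⟫
  ⟪⟫-cong = EqC.gfold B.isEquivalence ⟪_⟫ ⟪⟫-cong-∼

  hom : Hom (𝔾 𝔤 k A) B
  hom = record
    { to        = ⟪_⟫
    ; cong      = ⟪⟫-cong
    -- A related tuple is only equivalent to foci of a common play `p`; `φ p` preserves the relation
    -- there, and the result is transported back.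
    ; preserves = λ R (p , as , m , as∈R , xs≈as) →
        B.⟦⟧-resp R (λ i → B.sym (⟪⟫-cong (xs≈as i))) (PartialHom.preserves (φ p) R m as∈R)
    }

theorem3p8 : ∀ {s ℓ : Level} {σ : Signature s} (𝔤 : GuardKind) (k : ℕ) → 0 < k → (A B : Structure σ ℓ) →
    Inverse (Homs (𝔾 𝔤 k A) B) (WinningStrategies 𝔤 k A B)
    × (A ≼[ 𝔤 , k ] B ⇔ Hom (𝔾 𝔤 k A) B)
theorem3p8 𝔤 k _ A B = record
  { to        = HomToStrategy.winningStrategy 𝔤 k A B
  ; from      = StrategyToHom.hom 𝔤 k A B
  ; to-cong   = λ f≈g p x m → f≈g (p , x , m)
  ; from-cong = λ S≈T (p , x , m) → S≈T p x m
  -- The translations curry and uncurry one function of `p`, `x` and `m`, so both inverse laws are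
  -- the given equality rearranged.
  ; inverse   = (λ f≈S p x m → f≈S (p , x , m)) , (λ S≈f (p , x , m) → S≈f p x m)
  } , mk⇔ (StrategyToHom.hom 𝔤 k A B) (HomToStrategy.winningStrategy 𝔤 k A B)
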